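{- Let $\Omega=\{a,b\}$ be a set of cardinality two. There are exactly 13 structures of diassociative semigroup on $\Omega$, which restrict to 8 up to isomorphism, and exactly 45 structures of extended diassociative semigroup (EDS) on $\Omega$, which restrict to 24 up to isomorphism. Representatives of the 8 isomorphism classes of diassociative semigroups $(\leftarrow,\rightarrow)$ are A $=(c_a,c_a)$, B $=(c_a,p_2)$, C $=(\min,\min)$, D $=(p_1,c_a)$, E $=(p_1,p_1)$, F $=(p_1,p_2)$, G $=(p_2,p_2)$, H $=(m_1,m_1)$, and representatives of the 24 isomorphism classes of EDS are obtained by adding the following pairs $(\triangleleft,\triangleright)$: - A: $(c_a,c_a)$, $(p_2,p_1)$; - B: $(c_a,c_a)$, $(p_2,p_1)$; - C: $(c_a,c_a)$, $(c_a,c_b)$, $(p_2,p_1)$, $(c_b,c_a)$, $(c_b,c_b)$; - D: $(c_a,c_a)$, $(p_2,p_1)$; - E: $(c_a,c_a)$, $(c_a,c_b)$, $(p_2,p_1)$; - F: $(c_a,c_a)$, $(c_a,c_b)$, $(p_2,p_1)$, $(m_1,m_1)$, $(m_1,m_2)$; - G: $(c_a,c_a)$, $(c_a,c_b)$, $(p_2,p_1)$; - H: $(c_a,c_a)$, $(p_2,p_1)$. Exactly four of these 24 EDS are nondegenerate: F with $(p_2,p_1)$, F with $(m_1,m_1)$, F with $(m_1,m_2)$, and H with $(p_2,p_1)$.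
   Context: Binary operations on $\{a,b\}$ used: $c_a$, $c_b$ are the constant operations with value $a$, resp. $b$; $p_1(x,y)=x$; $p_2(x,y)=y$; $\min$ is the operation with $\min(b,b)=b$ and value $a$ on all other pairs; $m_1(x,y)=a$ if $x=y$ and $b$ otherwise; $m_2(x,y)=b$ if $x=y$ and $a$ otherwise. Extended diassociative semigroups. A diassociative semigroup is a set $\Omega$ with maps $\leftarrow,\rightarrow:\Omega\times\Omega\to\Omega$ such that for all $\alpha,\beta,\gamma\in\Omega$: $(\alpha\leftarrow\beta)\leftarrow\gamma=\alpha\leftarrow(\beta\leftarrow\gamma)=\alpha\leftarrow(\beta\rightarrow\gamma)$; $(\alpha\rightarrow\beta)\leftarrow\gamma=\alpha\rightarrow(\beta\leftarrow\gamma)$; $(\alpha\rightarrow\beta)\rightarrow\gamma=(\alpha\leftarrow\beta)\rightarrow\gamma=\alpha\rightarrow(\beta\rightarrow\gamma)$. An extended diassociative semigroup (EDS) is $(\Omega,\leftarrow,\rightarrow,\triangleleft,\triangleright)$ such that $(\Omega,\leftarrow,\rightarrow)$ is a diassociative semigroup and for all $\alpha,\beta,\gamma\in\Omega$: $\alpha\triangleright(\beta\leftarrow\gamma)=\alpha\triangleright\beta$; $(\alpha\rightarrow\beta)\triangleleft\gamma=\beta\triangleleft\gamma$; $(\alpha\triangleleft\beta)\leftarrow((\alpha\leftarrow\beta)\triangleleft\gamma)=\alpha\triangleleft(\beta\leftarrow\gamma)$; $(\alpha\triangleleft\beta)\triangleleft((\alpha\leftarrow\beta)\triangleleft\gamma)=\beta\triangleleft\gamma$;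 $(\alpha\triangleleft\beta)\rightarrow((\alpha\leftarrow\beta)\triangleleft\gamma)=\alpha\triangleleft(\beta\rightarrow\gamma)$; $(\alpha\triangleleft\beta)\triangleright((\alpha\leftarrow\beta)\triangleleft\gamma)=\beta\triangleright\gamma$; $(\alpha\triangleright(\beta\rightarrow\gamma))\leftarrow(\beta\triangleright\gamma)=(\alpha\leftarrow\beta)\triangleright\gamma$; $(\alpha\triangleright(\beta\rightarrow\gamma))\triangleleft(\beta\triangleright\gamma)=\alpha\triangleleft\beta$; $(\alpha\triangleright(\beta\rightarrow\gamma))\rightarrow(\beta\triangleright\gamma)=(\alpha\rightarrow\beta)\triangleright\gamma$; $(\alpha\triangleright(\beta\rightarrow\gamma))\triangleright(\beta\triangleright\gamma)=\alpha\triangleright\beta$. It is nondegenerate if the maps $(\alpha,\beta)\mapsto(\alpha\leftarrow\beta,\alpha\triangleleft\beta)$ and $(\alpha,\beta)\mapsto(\alpha\rightarrow\beta,\alpha\triangleright\beta)$ from $\Omega^2$ to $\Omega^2$ are bijective. Isomorphisms are bijections compatible with all the operations. -}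

module Defs where

open import Algebra.Core using (Op₂)
open import Data.Fin.Base using (Fin)
open import Data.List.Base using (List; []; _∷_; length; lookup)
open import Data.Nat.Base using (ℕ)
open import Data.Product.Base using (Σ; _×_; _,_; proj₁; proj₂; uncurry)
open import Function.Bundles using (Inverse; _↔_)
open import Function.Construct.Composition using (_↔-∘_)
open import Function.Construct.Identity using (↔-id)
open import Function.Construct.Symmetry using (↔-sym)
open import Function.Definitions using (Bijective)
open import Level using (Level; 0ℓ)
open import Relation.Binary.Bundles using (Setoid)
open import Relation.Binary.Structures using (IsEquivalence)
import Relation.Binary.Construct.On as On
open import Relation.Binary.PropositionalEquality
  using (_≡_; refl; sym; trans; cong; cong₂; setoid)

-- → is reserved in Agda, so the operations ←, → are written ⟵, ⟶.
record RawDS {ℓ} (Ω : Set ℓ) : Set ℓ where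
  constructor rawDS
  infix 7 _⟵_ _⟶_
  field
    _⟵_ _⟶_ : Op₂ Ω

record RawEDS {ℓ} (Ω : Set ℓ) : Set ℓ where
  constructor rawEDS
  infix 7 _◁_ _▷_
  field
    rawDSPart : RawDS Ω
    _◁_ _▷_   : Op₂ Ω
  open RawDS rawDSPart public

record IsDiassociativeSemigroup {ℓ} {Ω : Set ℓ} (R : RawDS Ω) : Set ℓ where
  open RawDS R
  field
    ⟵-assoc      : ∀ α β γ → (α ⟵ β) ⟵ γ ≡ α ⟵ (β ⟵ γ)
    ⟵-absorbs-⟶  : ∀ α β γ → α ⟵ (β ⟵ γ) ≡ α ⟵ (β ⟶ γ)
    ⟶-⟵-assoc    : ∀ α β γ → (α ⟶ β) ⟵ γ ≡ α ⟶ (β ⟵ γ)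
    ⟶-absorbs-⟵  : ∀ α β γ → (α ⟶ β) ⟶ γ ≡ (α ⟵ β) ⟶ γ
    ⟵⟶-assoc     : ∀ α β γ → (α ⟵ β) ⟶ γ ≡ α ⟶ (β ⟶ γ)

record IsEDS {ℓ} {Ω : Set ℓ} (R : RawEDS Ω) : Set ℓ where
  open RawEDS R
  field
    isDiassociativeSemigroup : IsDiassociativeSemigroup rawDSPart

    ▷-⟵    : ∀ α β γ → α ▷ (β ⟵ γ) ≡ α ▷ β
    ⟶-◁    : ∀ α β γ → (α ⟶ β) ◁ γ ≡ β ◁ γ

    ◁-⟵-◁  : ∀ α β γ → (α ◁ β) ⟵ ((α ⟵ β) ◁ γ) ≡ α ◁ (β ⟵ γ)
    ◁-◁-◁  : ∀ α β γ → (α ◁ β) ◁ ((α ⟵ β) ◁ γ) ≡ β ◁ γ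
    ◁-⟶-◁  : ∀ α β γ → (α ◁ β) ⟶ ((α ⟵ β) ◁ γ) ≡ α ◁ (β ⟶ γ)
    ◁-▷-◁  : ∀ α β γ → (α ◁ β) ▷ ((α ⟵ β) ◁ γ) ≡ β ▷ γ

    ▷-⟵-▷  : ∀ α β γ → (α ▷ (β ⟶ γ)) ⟵ (β ▷ γ) ≡ (α ⟵ β) ▷ γ
    ▷-◁-▷  : ∀ α β γ → (α ▷ (β ⟶ γ)) ◁ (β ▷ γ) ≡ α ◁ β
    ▷-⟶-▷  : ∀ α β γ → (α ▷ (β ⟶ γ)) ⟶ (β ▷ γ) ≡ (α ⟶ β) ▷ γ
    ▷-▷-▷  : ∀ α β γ → (α ▷ (β ⟶ γ)) ▷ (β ▷ γ) ≡ α ▷ β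

record DiassociativeSemigroup {ℓ} (Ω : Set ℓ) : Set ℓ where
  field
    raw                      : RawDS Ω
    isDiassociativeSemigroup : IsDiassociativeSemigroup raw

record EDS {ℓ} (Ω : Set ℓ) : Set ℓ where
  field
    raw   : RawEDS Ω
    isEDS : IsEDS raw

Nondegenerate : ∀ {ℓ} {Ω : Set ℓ} → RawEDS Ω → Set ℓ
Nondegenerate {Ω = Ω} R =
  Bijective {A = Ω × Ω} {B = Ω × Ω} _≡_ _≡_ (λ (α , β) → (α ⟵ β , α ◁ β)) ×
  Bijective {A = Ω × Ω} {B = Ω × Ω} _≡_ _≡_ (λ (α , β) → (α ⟶ β , α ▷ β))
  where open RawEDS R

-- Equality of structures: the operations agree pointwise.  (Without
-- function extensionality _≡_ would be too fine.)

infix 4 _≈Op_ _≈DS_ _≈EDS_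

_≈Op_ : ∀ {ℓ} {Ω : Set ℓ} → Op₂ Ω → Op₂ Ω → Set ℓ
f ≈Op g = ∀ x y → f x y ≡ g x y

_≈DS_ : ∀ {ℓ} {Ω : Set ℓ} → RawDS Ω → RawDS Ω → Set ℓ
R ≈DS S = (R._⟵_ ≈Op S._⟵_) × (R._⟶_ ≈Op S._⟶_)
  where module R = RawDS R
        module S = RawDS S

_≈EDS_ : ∀ {ℓ} {Ω : Set ℓ} → RawEDS Ω → RawEDS Ω → Set ℓ
R ≈EDS S = (R.rawDSPart ≈DS S.rawDSPart) × (R._◁_ ≈Op S._◁_) × (R._▷_ ≈Op S._▷_)
  where module R = RawEDS R
        module S = RawEDS S

≈DS-isEquivalence : ∀ {ℓ} {Ω : Set ℓ} → IsEquivalence (_≈DS_ {Ω = Ω})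
≈DS-isEquivalence = record
  { refl  = (λ _ _ → refl) , (λ _ _ → refl)
  ; sym   = λ (p , q) → (λ x y → sym (p x y)) , (λ x y → sym (q x y))
  ; trans = λ (p , q) (p′ , q′) →
      (λ x y → trans (p x y) (p′ x y)) , (λ x y → trans (q x y) (q′ x y))
  }

≈EDS-isEquivalence : ∀ {ℓ} {Ω : Set ℓ} → IsEquivalence (_≈EDS_ {Ω = Ω})
≈EDS-isEquivalence = record
  { refl  = DS.refl , (λ _ _ → refl) , (λ _ _ → refl)
  ; sym   = λ (d , p , q) →
      DS.sym d , (λ x y → sym (p x y)) , (λ x y → sym (q x y))
  ; trans = λ (d , p , q) (d′ , p′ , q′) →
      DS.trans d d′ ,
      (λ x y → trans (p x y) (p′ x y)) , (λ x y → trans (q x y) (q′ x y))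
  }
  where module DS = IsEquivalence ≈DS-isEquivalence

Compatible : ∀ {ℓ₁ ℓ₂} {Ω₁ : Set ℓ₁} {Ω₂ : Set ℓ₂} →
             (Ω₁ → Ω₂) → Op₂ Ω₁ → Op₂ Ω₂ → Set _
Compatible φ f g = ∀ x y → φ (f x y) ≡ g (φ x) (φ y)

infix 4 _≅DS_ _≅EDS_

_≅DS_ : ∀ {ℓ₁ ℓ₂} {Ω₁ : Set ℓ₁} {Ω₂ : Set ℓ₂} → RawDS Ω₁ → RawDS Ω₂ → Set _
_≅DS_ {Ω₁ = Ω₁} {Ω₂ = Ω₂} R S = Σ (Ω₁ ↔ Ω₂) λ φ →
  Compatible (Inverse.to φ) R._⟵_ S._⟵_ ×
  Compatible (Inverse.to φ) R._⟶_ S._⟶_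
  where module R = RawDS R
        module S = RawDS S

_≅EDS_ : ∀ {ℓ₁ ℓ₂} {Ω₁ : Set ℓ₁} {Ω₂ : Set ℓ₂} → RawEDS Ω₁ → RawEDS Ω₂ → Set _
_≅EDS_ {Ω₁ = Ω₁} {Ω₂ = Ω₂} R S = Σ (Ω₁ ↔ Ω₂) λ φ →
  Compatible (Inverse.to φ) R._⟵_ S._⟵_ ×
  Compatible (Inverse.to φ) R._⟶_ S._⟶_ ×
  Compatible (Inverse.to φ) R._◁_ S._◁_ ×
  Compatible (Inverse.to φ) R._▷_ S._▷_
  where module R = RawEDS R
        module S = RawEDS S

module _ {ℓ} {Ω : Set ℓ} where

  compatible-sym : (φ : Ω ↔ Ω) (f g : Op₂ Ω) →
                   Compatible (Inverse.to φ) f g → Compatible (Inverse.from φ) g f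
  compatible-sym φ f g h x y =
    trans (cong from (sym (trans (h (from x) (from y))
                                 (cong₂ g (strictlyInverseˡ x) (strictlyInverseˡ y)))))
          (strictlyInverseʳ (f (from x) (from y)))
    where open Inverse φ

  ≅DS-isEquivalence : IsEquivalence (_≅DS_ {Ω₁ = Ω} {Ω₂ = Ω})
  ≅DS-isEquivalence = record
    { refl  = ↔-id Ω , (λ _ _ → refl) , (λ _ _ → refl)
    ; sym   = λ (φ , p , q) →
        ↔-sym φ , compatible-sym φ _ _ p , compatible-sym φ _ _ q
    ; trans = λ (φ , p , q) (ψ , p′ , q′) →
        (ψ ↔-∘ φ) ,
        (λ x y → trans (cong (Inverse.to ψ) (p x y)) (p′ _ _)) ,
        (λ x y → trans (cong (Inverse.to ψ) (q x y)) (q′ _ _))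
    }

  ≅EDS-isEquivalence : IsEquivalence (_≅EDS_ {Ω₁ = Ω} {Ω₂ = Ω})
  ≅EDS-isEquivalence = record
    { refl  = ↔-id Ω ,
        (λ _ _ → refl) , (λ _ _ → refl) , (λ _ _ → refl) , (λ _ _ → refl)
    ; sym   = λ (φ , p , q , r , s) →
        ↔-sym φ ,
        compatible-sym φ _ _ p , compatible-sym φ _ _ q ,
        compatible-sym φ _ _ r , compatible-sym φ _ _ s
    ; trans = λ (φ , p , q , r , s) (ψ , p′ , q′ , r′ , s′) →
        (ψ ↔-∘ φ) ,
        (λ x y → trans (cong (Inverse.to ψ) (p x y)) (p′ _ _)) ,
        (λ x y → trans (cong (Inverse.to ψ) (q x y)) (q′ _ _)) ,
        (λ x y → trans (cong (Inverse.to ψ) (r x y)) (r′ _ _)) ,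
        (λ x y → trans (cong (Inverse.to ψ) (s x y)) (s′ _ _))
    }

-- Counting.  A set of structures is the setoid for equality, and a set
-- of isomorphism classes is the setoid for isomorphism.

HasCardinality : ∀ {c ℓ} → Setoid c ℓ → ℕ → Set _
HasCardinality S n = Inverse S (setoid (Fin n))

DS-setoid DS-classes EDS-setoid EDS-classes : ∀ {ℓ} → Set ℓ → Setoid ℓ ℓ
DS-setoid Ω = record
  { isEquivalence = On.isEquivalence (DiassociativeSemigroup.raw {Ω = Ω}) ≈DS-isEquivalence }
DS-classes Ω = record
  { isEquivalence = On.isEquivalence (DiassociativeSemigroup.raw {Ω = Ω}) ≅DS-isEquivalence }
EDS-setoid Ω = record
  { isEquivalence = On.isEquivalence (EDS.raw {Ω = Ω}) ≈EDS-isEquivalence }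
EDS-classes Ω = record
  { isEquivalence = On.isEquivalence (EDS.raw {Ω = Ω}) ≅EDS-isEquivalence }

data Two : Set where
  a b : Two

c-a c-b p₁ p₂ min m₁ m₂ : Op₂ Two

c-a _ _ = a

c-b _ _ = b

p₁ x _ = x

p₂ _ y = y

min b b = b
min a _ = a
min b a = a

m₁ a a = a
m₁ b b = a
m₁ a b = b
m₁ b a = b

m₂ a a = b
m₂ b b = b
m₂ a b = a
m₂ b a = a

data DSLabel : Set where
  A B C D E F G H : DSLabel

dsRep : DSLabel → RawDS Two
dsRep A = rawDS c-a c-a
dsRep B = rawDS c-a p₂
dsRep C = rawDS min min
dsRep D = rawDS p₁ c-a
dsRep E = rawDS p₁ p₁
dsRep F = rawDS p₁ p₂
dsRep G = rawDS p₂ p₂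
dsRep H = rawDS m₁ m₁

extensions : DSLabel → List (Op₂ Two × Op₂ Two)
extensions A = (c-a , c-a) ∷ (p₂ , p₁) ∷ []
extensions B = (c-a , c-a) ∷ (p₂ , p₁) ∷ []
extensions C = (c-a , c-a) ∷ (c-a , c-b) ∷ (p₂ , p₁) ∷ (c-b , c-a) ∷ (c-b , c-b) ∷ []
extensions D = (c-a , c-a) ∷ (p₂ , p₁) ∷ []
extensions E = (c-a , c-a) ∷ (c-a , c-b) ∷ (p₂ , p₁) ∷ []
extensions F = (c-a , c-a) ∷ (c-a , c-b) ∷ (p₂ , p₁) ∷ (m₁ , m₁) ∷ (m₁ , m₂) ∷ []
extensions G = (c-a , c-a) ∷ (c-a , c-b) ∷ (p₂ , p₁) ∷ []
extensions H = (c-a , c-a) ∷ (p₂ , p₁) ∷ []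

-- A diassociative representative together with a position in its list
-- of extensions.
EDSLabel : Set
EDSLabel = Σ DSLabel λ X → Fin (length (extensions X))

edsRep : EDSLabel → RawEDS Two
edsRep (X , i) = uncurry (rawEDS (dsRep X)) (lookup (extensions X) i)

nondegenerateReps : List (RawEDS Two)
nondegenerateReps =
  rawEDS (dsRep F) p₂ p₁ ∷
  rawEDS (dsRep F) m₁ m₁ ∷
  rawEDS (dsRep F) m₁ m₂ ∷
  rawEDS (dsRep H) p₂ p₁ ∷ []

-- The labels of the nondegenerate representatives; proofs of
-- nondegeneracy are ignored, so only labels are counted.
nondegenerateLabels : Setoid 0ℓ 0ℓ
nondegenerateLabels = On.setoid
  {B = Σ EDSLabel (λ i → Nondegenerate (edsRep i))} (setoid EDSLabel) proj₁

{-# OPTIONS --safe #-}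

-- An operation on {a , b} is determined by its four values, so every
-- assertion reduces to a finite check on tables of values, once it is
-- known that the axioms and isomorphism only depend on these values and
-- that the only bijections of {a , b} are the identity and the swap.
module Submission where

open import Defs
open import Algebra.Core using (Op₂)
open import Axiom.UniquenessOfIdentityProofs.WithK using (uip)
open import Data.Fin.Base using (Fin; zero; suc)
import Data.Fin.Properties as Fin
open import Data.List.Base
  using (List; []; _∷_; allFin; cartesianProduct; concatMap; filter; length; lookup; map)
open import Data.List.Membership.Propositional using (_∈_; find; lose)
open import Data.List.Membership.Propositional.Properties
  using (∈-allFin; ∈-cartesianProduct⁺; ∈-cartesianProduct⁻; ∈-concatMap⁺; ∈-filter⁺;
         ∈-filter⁻; ∈-lookup; ∈-map⁺)
import Data.List.Membership.Setoid.Properties as Membershipₛ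
open import Data.List.Relation.Unary.All as All using (All)
open import Data.List.Relation.Unary.Any using (Any; any?; here; there; index)
open import Data.List.Relation.Unary.Any.Properties using (lookup-index)
open import Data.List.Relation.Unary.Unique.DecPropositional using (unique?)
open import Data.List.Relation.Unary.Unique.Propositional using (Unique)
import Data.List.Relation.Unary.Unique.Propositional.Properties as Unique
open import Data.Nat.Base using (ℕ)
open import Data.Product
  using (Σ; ∃; ∃!; _×_; _,_; proj₁; proj₂; uncurry; map₂)
open import Data.Product.Properties using (≡-dec)
open import Data.Sum.Base using (_⊎_; inj₁; inj₂; [_,_]′) renaming (map to ⊎-map)
open import Data.Unit.Base using (tt)
open import Function.Base using (_∘_; id)
open import Function.Bundles using (Equivalence; Injection; Inverse; _⇔_; _↔_; mk⇔; mk↔ₛ′)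
open import Function.Construct.Identity using (↔-id)
open import Function.Definitions using (Bijective)
open import Function.Properties.Inverse using (↔⇒↣)
open import Level using (0ℓ)
open import Relation.Binary.Bundles using (Setoid)
open import Relation.Binary.Core using (Rel)
open import Relation.Binary.Definitions using (DecidableEquality; _Respects_)
import Relation.Binary.Definitions as Binary
open import Relation.Binary.PropositionalEquality
  using (_≡_; _≗_; refl; sym; trans; cong; cong₂; setoid)
open import Relation.Binary.Structures using (IsEquivalence)
open import Relation.Nullary.Decidable
  using (Dec; yes; no; True; toWitness; map′; _×-dec_; _⊎-dec_; _→-dec_)
open import Relation.Nullary.Negation using (contradiction)
open import Relation.Unary using (Decidable; U; _⊆_; _≐_; _⟨×⟩_)

-- Finite enumerations

index-∈-lookup : ∀ {A : Set} (xs : List A) (i : Fin (length xs)) →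
                 index (∈-lookup {xs = xs} i) ≡ i
index-∈-lookup (_ ∷ _)  zero    = refl
index-∈-lookup (_ ∷ xs) (suc i) = cong suc (index-∈-lookup xs i)

-- A listing is an explicit finite model of the subset cut out by `P`: soundness and completeness
-- fix which elements occur, and `unique` lets the length of the list serve as the cardinality.
record Listing {A : Set} (P : A → Set) : Set where
  field
    elements : List A
    sound    : ∀ {x} → x ∈ elements → P x
    complete : ∀ {x} → P x → x ∈ elements
    unique   : Unique elements

  size : ℕ
  size = length elements

  -- In a duplicate-free list membership is a proposition, by uniqueness of identity proofs. The
  -- position of an element is therefore independent of how its membership was proved.
  index-unique : ∀ {x} (p q : x ∈ elements) → index p ≡ index q
  index-unique p q =
    cong index (Membershipₛ.unique⇒irrelevant (setoid A) uip unique p q)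

  -- Proof by computation: once the decision procedure evaluates to `yes` on the whole list, the
  -- implicit argument has the unit type and is filled in automatically. Completeness then carries
  -- the result to every element of `P`.
  check : ∀ {Q : A → Set} (Q? : Decidable Q) → {True (All.all? Q? elements)} →
          ∀ x → P x → Q x
  check Q? {t} _ = All.lookup (toWitness t) ∘ complete

open Listing using (check)

-- Equal positions in the covering list force equal elements, so comparing positions in `Fin`
-- replaces a quadratic case analysis on constructors.
enumerable-≟ : ∀ {A : Set} {xs : List A} → (∀ x → x ∈ xs) → DecidableEquality A
enumerable-≟ all∈ x y = map′
  (Membershipₛ.index-injective (setoid _) (all∈ x) (all∈ y))
  (cong (index ∘ all∈))
  (index (all∈ x) Fin.≟ index (all∈ y))

enumeration : ∀ {A : Set} {xs : List A} (all∈ : ∀ x → x ∈ xs) →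
              {True (unique? (enumerable-≟ all∈) xs)} → Listing {A} U
enumeration {xs = xs} all∈ {u} = record
  { elements = xs
  ; sound    = λ _ → tt
  ; complete = λ _ → all∈ _
  ; unique   = toWitness u
  }

module _ {A : Set} {P Q : A → Set} where

  ≐-listing : P ≐ Q → Listing P → Listing Q
  ≐-listing (P⊆Q , Q⊆P) L = record
    { elements = elements
    ; sound    = P⊆Q ∘ sound
    ; complete = complete ∘ Q⊆P
    ; unique   = unique
    }
    where open Listing L

  filter-listing : Q ⊆ P → Decidable Q → Listing P → Listing Q
  filter-listing Q⊆P Q? L = record
    { elements = filter Q? elements
    ; sound    = proj₂ ∘ ∈-filter⁻ Q? {xs = elements}
    ; complete = λ q → ∈-filter⁺ Q? (complete (Q⊆P q)) q
    ; unique   = Unique.filter⁺ Q? unique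
    }
    where open Listing L

×-listing : ∀ {A B : Set} {P : A → Set} {Q : B → Set} →
            Listing P → Listing Q → Listing (P ⟨×⟩ Q)
×-listing L M = record
  { elements = cartesianProduct L.elements M.elements
  ; sound    = λ xy∈ → let x∈ , y∈ = ∈-cartesianProduct⁻ L.elements M.elements xy∈
                       in L.sound x∈ , M.sound y∈
  ; complete = λ (p , q) → ∈-cartesianProduct⁺ (L.complete p) (M.complete q)
  ; unique   = Unique.cartesianProduct⁺ L.unique M.unique
  }
  where module L = Listing L
        module M = Listing M

×-listing-U : ∀ {A B : Set} → Listing {A} U → Listing {B} U → Listing {A × B} U
×-listing-U L M = ≐-listing (_ , _) (×-listing L M)

module _ {A : Set} (L : Listing {A} U) {P : A → Set} (P? : Decidable P) where
  open Listing L

  ∀? : Dec (∀ x → P x)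
  ∀? = map′ (λ all x → All.lookup all (complete tt)) (λ p → All.universal p elements)
            (All.all? P? elements)

  ∃? : Dec (∃ P)
  ∃? = map′ (map₂ proj₂ ∘ find) (λ (x , p) → lose (complete tt) p) (any? P? elements)

module _ {A B : Set} (L : Listing {A} U) (M : Listing {B} U)
         (_≟A_ : DecidableEquality A) (_≟B_ : DecidableEquality B) where

  bijective? : (f : A → B) → Dec (Bijective _≡_ _≡_ f)
  bijective? f =
    map′ (λ inj → inj _ _) (λ inj _ _ → inj)
      (∀? L λ x → ∀? L λ y → (f x ≟B f y) →-dec (x ≟A y))
    ×-dec
    -- Library surjectivity asks for `f z ≡ y` at every `z` equal to the witness; this translates
    -- between that form and the plain equation `f x ≡ y`.
    map′ (λ surj y → map₂ (λ { eq refl → eq }) (surj y))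
         (λ surj y → map₂ (λ eq → eq refl) (surj y))
      (∀? M λ y → ∃? L λ x → f x ≟B y)

_⇔-dec_ : ∀ {P Q : Set} → Dec P → Dec Q → Dec (P ⇔ Q)
P? ⇔-dec Q? = map′ (uncurry mk⇔) (λ e → Equivalence.to e , Equivalence.from e)
                   ((P? →-dec Q?) ×-dec (Q? →-dec P?))

-- Cardinality of setoids through codes

module _ (S : Setoid 0ℓ 0ℓ) {A : Set} {P : A → Set} (L : Listing P) where
  open Setoid S using (Carrier; _≈_)
  open Listing L

  -- The code is a complete invariant for `_≈_` whose values are exactly the elements of `P`.
  -- Sending a structure to the position of its code in the listing is then a bijection of the
  -- setoid with `Fin size`.
  coded-cardinality :
    (code : Carrier → A) → (∀ s → P (code s)) →
    (∀ {s t} → s ≈ t → code s ≡ code t) →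
    (∀ {s t} → code s ≡ code t → s ≈ t) →
    (decode : ∀ x → P x → ∃ λ s → code s ≡ x) →
    ∀ {n} → size ≡ n → HasCardinality S n
  coded-cardinality code code-sound code-cong code-injective decode refl = record
    { to        = position
    ; from      = structure
    ; to-cong   = λ s≈t → position-cong (code-cong s≈t)
    ; from-cong = λ { refl → code-injective refl }
    ; inverse   =
        (λ {i} s≈ → trans (position-cong (code-cong s≈)) (position-structure i)) ,
        (λ { {s} refl → code-injective (trans (code-structure (position s))
                          (sym (lookup-index (complete (code-sound s))))) })
    }
    where
    position : Carrier → Fin size
    position s = index (complete (code-sound s))

    structure : Fin size → Carrier
    structure i = proj₁ (decode (lookup elements i) (sound (∈-lookup i)))

    code-structure : ∀ i → code (structure i) ≡ lookup elements i
    code-structure i = proj₂ (decode (lookup elements i) (sound (∈-lookup i)))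

    index-cong : ∀ {x y} → x ≡ y → (p : x ∈ elements) (q : y ∈ elements) →
                 index p ≡ index q
    index-cong refl = index-unique

    position-cong : ∀ {s t} → code s ≡ code t → position s ≡ position t
    position-cong eq = index-cong eq _ _

    position-structure : ∀ i → position (structure i) ≡ i
    position-structure i =
      -- The code of `structure i` is the `i`-th entry, but its membership proof comes from
      -- `complete`; `index-cong` exchanges it for `∈-lookup i`, whose index is `i`.
      trans (index-cong (code-structure i) _ (∈-lookup i)) (index-∈-lookup elements i)

-- The code of a structure is the label of its unique representative. Uniqueness makes the label
-- invariant under the equivalence, and each label is attained by its own representative.
classes-cardinality :
  ∀ (S : Setoid 0ℓ 0ℓ) {A : Set} (L : Listing {A} U) (rep : A → Setoid.Carrier S) →
  (∀ s → ∃! _≡_ λ x → Setoid._≈_ S s (rep x)) →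
  ∀ {n} → Listing.size L ≡ n → HasCardinality S n
classes-cardinality S L rep classify = coded-cardinality S L
  class _
  (λ {s} {t} s≈t → class-unique s (S.trans s≈t (≈-rep t)))
  (λ {s} {t} eq → S.trans (≈-rep s)
    (S.trans (S.reflexive (cong rep eq)) (S.sym (≈-rep t))))
  (λ x _ → rep x , class-unique (rep x) S.refl)
  where
  module S = Setoid S

  class = λ s → proj₁ (classify s)

  ≈-rep : ∀ s → s S.≈ rep (class s)
  ≈-rep s = proj₁ (proj₂ (classify s))

  class-unique : ∀ s {x} → s S.≈ rep x → class s ≡ x
  class-unique s = proj₂ (proj₂ (classify s))

-- Uniqueness follows from pairwise inequivalence of the representatives. The intermediate `t`
-- allows existence to be established on a tabulated copy of `s`, where a finite search is possible.
∃!-representative :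
  ∀ {X A : Set} {_≈_ : Rel X 0ℓ} → IsEquivalence _≈_ → (rep : A → X) →
  (∀ x y → rep x ≈ rep y → x ≡ y) →
  ∀ {s t} → s ≈ t → (∃ λ x → t ≈ rep x) → ∃! _≡_ λ x → s ≈ rep x
∃!-representative isEquivalence rep rep-injective s≈t (x , t≈x) =
  x , ≈-trans s≈t t≈x ,
  λ {y} s≈y → rep-injective x y (≈-trans (≈-sym (≈-trans s≈t t≈x)) s≈y)
  where open IsEquivalence isEquivalence renaming (trans to ≈-trans; sym to ≈-sym)

-- Operations, structures and isomorphisms on {a , b}

two : Listing {Two} U
two = enumeration {xs = a ∷ b ∷ []} λ { a → here refl ; b → there (here refl) }

infix 4 _≟_

_≟_ : DecidableEquality Two
a ≟ a = yes refl
a ≟ b = no λ ()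
b ≟ a = no λ ()
b ≟ b = yes refl

∀₂? : {P : Two → Two → Set} → Binary.Decidable P → Dec (∀ x y → P x y)
∀₂? P? = ∀? two λ x → ∀? two λ y → P? x y

∀₃? : {P : Two → Two → Two → Set} → (∀ x y z → Dec (P x y z)) → Dec (∀ x y z → P x y z)
∀₃? P? = ∀? two λ x → ∀₂? (P? x)

isDiassociativeSemigroup? : Decidable (IsDiassociativeSemigroup {Ω = Two})
isDiassociativeSemigroup? R = map′
  (λ (p , q , r , s , t) → record
    { ⟵-assoc = p ; ⟵-absorbs-⟶ = q ; ⟶-⟵-assoc = r ; ⟶-absorbs-⟵ = s ; ⟵⟶-assoc = t })
  (λ ds → let open IsDiassociativeSemigroup ds in
    ⟵-assoc , ⟵-absorbs-⟶ , ⟶-⟵-assoc , ⟶-absorbs-⟵ , ⟵⟶-assoc)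
  (∀₃? (λ α β γ → (α ⟵ β) ⟵ γ ≟ α ⟵ (β ⟵ γ)) ×-dec
   ∀₃? (λ α β γ → α ⟵ (β ⟵ γ) ≟ α ⟵ (β ⟶ γ)) ×-dec
   ∀₃? (λ α β γ → (α ⟶ β) ⟵ γ ≟ α ⟶ (β ⟵ γ)) ×-dec
   ∀₃? (λ α β γ → (α ⟶ β) ⟶ γ ≟ (α ⟵ β) ⟶ γ) ×-dec
   ∀₃? (λ α β γ → (α ⟵ β) ⟶ γ ≟ α ⟶ (β ⟶ γ)))
  where open RawDS R

isEDS? : Decidable (IsEDS {Ω = Two})
isEDS? R = map′
  (λ (d , p , q , r , s , t , u , v , w , x , y) → record
    { isDiassociativeSemigroup = d
    ; ▷-⟵ = p ; ⟶-◁ = q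
    ; ◁-⟵-◁ = r ; ◁-◁-◁ = s ; ◁-⟶-◁ = t ; ◁-▷-◁ = u
    ; ▷-⟵-▷ = v ; ▷-◁-▷ = w ; ▷-⟶-▷ = x ; ▷-▷-▷ = y
    })
  (λ eds → let open IsEDS eds in
    isDiassociativeSemigroup , ▷-⟵ , ⟶-◁ ,
    ◁-⟵-◁ , ◁-◁-◁ , ◁-⟶-◁ , ◁-▷-◁ , ▷-⟵-▷ , ▷-◁-▷ , ▷-⟶-▷ , ▷-▷-▷)
  (isDiassociativeSemigroup? rawDSPart ×-dec
   ∀₃? (λ α β γ → α ▷ (β ⟵ γ) ≟ α ▷ β) ×-dec
   ∀₃? (λ α β γ → (α ⟶ β) ◁ γ ≟ β ◁ γ) ×-dec
   ∀₃? (λ α β γ → (α ◁ β) ⟵ ((α ⟵ β) ◁ γ) ≟ α ◁ (β ⟵ γ)) ×-dec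
   ∀₃? (λ α β γ → (α ◁ β) ◁ ((α ⟵ β) ◁ γ) ≟ β ◁ γ) ×-dec
   ∀₃? (λ α β γ → (α ◁ β) ⟶ ((α ⟵ β) ◁ γ) ≟ α ◁ (β ⟶ γ)) ×-dec
   ∀₃? (λ α β γ → (α ◁ β) ▷ ((α ⟵ β) ◁ γ) ≟ β ▷ γ) ×-dec
   ∀₃? (λ α β γ → (α ▷ (β ⟶ γ)) ⟵ (β ▷ γ) ≟ (α ⟵ β) ▷ γ) ×-dec
   ∀₃? (λ α β γ → (α ▷ (β ⟶ γ)) ◁ (β ▷ γ) ≟ α ◁ β) ×-dec
   ∀₃? (λ α β γ → (α ▷ (β ⟶ γ)) ⟶ (β ▷ γ) ≟ (α ⟶ β) ▷ γ) ×-dec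
   ∀₃? (λ α β γ → (α ▷ (β ⟶ γ)) ▷ (β ▷ γ) ≟ α ▷ β))
  where open RawEDS R

nondegenerate? : Decidable (Nondegenerate {Ω = Two})
nondegenerate? R = bij? _ ×-dec bij? _
  where
  two² = ×-listing-U two two
  bij? = bijective? two² two² (≡-dec _≟_ _≟_) (≡-dec _≟_ _≟_)

_≈Op?_ : Binary.Decidable (_≈Op_ {Ω = Two})
f ≈Op? g = ∀₂? λ x y → f x y ≟ g x y

_≈EDS?_ : Binary.Decidable (_≈EDS_ {Ω = Two})
R ≈EDS? S = ((R._⟵_ ≈Op? S._⟵_) ×-dec (R._⟶_ ≈Op? S._⟶_)) ×-dec
            (R._◁_ ≈Op? S._◁_) ×-dec (R._▷_ ≈Op? S._▷_)
  where module R = RawEDS R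
        module S = RawEDS S

flip₂ : Two → Two
flip₂ a = b
flip₂ b = a

flip₂-↔ : Two ↔ Two
flip₂-↔ = mk↔ₛ′ flip₂ flip₂ flip₂-involutive flip₂-involutive
  where
  flip₂-involutive : flip₂ ∘ flip₂ ≗ id
  flip₂-involutive a = refl
  flip₂-involutive b = refl

-- Of the four possible pairs of values at `a` and `b`, the two constant ones contradict
-- injectivity.
bijection-on-Two : (φ : Two ↔ Two) → Inverse.to φ ≗ id ⊎ Inverse.to φ ≗ flip₂
bijection-on-Two φ with Inverse.to φ a in φa | Inverse.to φ b in φb
... | a | b = inj₁ λ { a → φa ; b → φb }
... | b | a = inj₂ λ { a → φa ; b → φb }
... | a | a = contradiction (Injection.injective (↔⇒↣ φ) (trans φa (sym φb))) λ ()
... | b | b = contradiction (Injection.injective (↔⇒↣ φ) (trans φa (sym φb))) λ ()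

-- Bijections are known only up to pointwise equality, hence the requirement that `Q` respect it;
-- trying the identity and the swap then decides existence.
∃-bijection? : {Q : (Two → Two) → Set} → Q Respects _≗_ → Decidable Q →
               Dec (Σ (Two ↔ Two) (Q ∘ Inverse.to))
∃-bijection? resp Q? = map′
  [ (λ q → ↔-id Two , q) , (λ q → flip₂-↔ , q) ]′
  (λ (φ , q) → ⊎-map (λ eq → resp eq q) (λ eq → resp eq q) (bijection-on-Two φ))
  (Q? id ⊎-dec Q? flip₂)

compatible-resp : ∀ (f g : Op₂ Two) → (λ φ → Compatible φ f g) Respects _≗_
compatible-resp f g φ≗ψ h x y =
  trans (sym (φ≗ψ (f x y))) (trans (h x y) (cong₂ g (φ≗ψ x) (φ≗ψ y)))

compatible? : (f g : Op₂ Two) → Decidable (λ φ → Compatible φ f g)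
compatible? f g φ = ∀₂? λ x y → φ (f x y) ≟ g (φ x) (φ y)

_≅DS?_ : Binary.Decidable (_≅DS_ {Ω₁ = Two} {Ω₂ = Two})
R ≅DS? S = ∃-bijection?
  (λ eq (p , q) → compatible-resp R._⟵_ S._⟵_ eq p , compatible-resp R._⟶_ S._⟶_ eq q)
  (λ φ → compatible? R._⟵_ S._⟵_ φ ×-dec compatible? R._⟶_ S._⟶_ φ)
  where module R = RawDS R
        module S = RawDS S

_≅EDS?_ : Binary.Decidable (_≅EDS_ {Ω₁ = Two} {Ω₂ = Two})
R ≅EDS? S = ∃-bijection?
  (λ eq (p , q , r , s) → compatible-resp R._⟵_ S._⟵_ eq p , compatible-resp R._⟶_ S._⟶_ eq q ,
                          compatible-resp R._◁_ S._◁_ eq r , compatible-resp R._▷_ S._▷_ eq s)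
  (λ φ → compatible? R._⟵_ S._⟵_ φ ×-dec compatible? R._⟶_ S._⟶_ φ ×-dec
         compatible? R._◁_ S._◁_ φ ×-dec compatible? R._▷_ S._▷_ φ)
  where module R = RawEDS R
        module S = RawEDS S

-- Invariance under pointwise equality

-- The operation and its arguments change simultaneously, so nested uses of `_⟨∙⟩_` prove that a
-- compound term has the same value in two pointwise equal structures. This carries the axioms from
-- a structure to its table, which need not be propositionally equal to it.
module Congruence {Ω : Set} {f g : Op₂ Ω} (f≈g : f ≈Op g) where

  _⟨∙⟩_ : ∀ {x x′ y y′} → x ≡ x′ → y ≡ y′ → f x y ≡ g x′ y′
  refl ⟨∙⟩ refl = f≈g _ _

≡-resp₂ : ∀ {A : Set} {x x′ y y′ : A} → x ≡ x′ → y ≡ y′ → x ≡ y → x′ ≡ y′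
≡-resp₂ refl refl eq = eq

-- In the congruence proofs below, ∙ marks a variable, so that each proof has
-- the shape of the term it is about.
IsDiassociativeSemigroup-resp : ∀ {Ω : Set} → IsDiassociativeSemigroup {Ω = Ω} Respects _≈DS_
IsDiassociativeSemigroup-resp (⟵≈ , ⟶≈) ds = record
  { ⟵-assoc     = λ α β γ → ≡-resp₂ ((∙ ⟵ ∙) ⟵ ∙) (∙ ⟵ (∙ ⟵ ∙)) (⟵-assoc α β γ)
  ; ⟵-absorbs-⟶ = λ α β γ → ≡-resp₂ (∙ ⟵ (∙ ⟵ ∙)) (∙ ⟵ (∙ ⟶ ∙)) (⟵-absorbs-⟶ α β γ)
  ; ⟶-⟵-assoc   = λ α β γ → ≡-resp₂ ((∙ ⟶ ∙) ⟵ ∙) (∙ ⟶ (∙ ⟵ ∙)) (⟶-⟵-assoc α β γ)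
  ; ⟶-absorbs-⟵ = λ α β γ → ≡-resp₂ ((∙ ⟶ ∙) ⟶ ∙) ((∙ ⟵ ∙) ⟶ ∙) (⟶-absorbs-⟵ α β γ)
  ; ⟵⟶-assoc    = λ α β γ → ≡-resp₂ ((∙ ⟵ ∙) ⟶ ∙) (∙ ⟶ (∙ ⟶ ∙)) (⟵⟶-assoc α β γ)
  }
  where
  open IsDiassociativeSemigroup ds

  ∙ : ∀ {α} → α ≡ α
  ∙ = refl
  open Congruence ⟵≈ renaming (_⟨∙⟩_ to _⟵_)
  open Congruence ⟶≈ renaming (_⟨∙⟩_ to _⟶_)

IsEDS-resp : ∀ {Ω : Set} → IsEDS {Ω = Ω} Respects _≈EDS_
IsEDS-resp (ds≈@(⟵≈ , ⟶≈) , ◁≈ , ▷≈) eds = record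
  { isDiassociativeSemigroup = IsDiassociativeSemigroup-resp ds≈ isDiassociativeSemigroup
  ; ▷-⟵   = λ α β γ → ≡-resp₂ (∙ ▷ (∙ ⟵ ∙)) (∙ ▷ ∙) (▷-⟵ α β γ)
  ; ⟶-◁   = λ α β γ → ≡-resp₂ ((∙ ⟶ ∙) ◁ ∙) (∙ ◁ ∙) (⟶-◁ α β γ)
  ; ◁-⟵-◁ = λ α β γ → ≡-resp₂ ((∙ ◁ ∙) ⟵ ((∙ ⟵ ∙) ◁ ∙)) (∙ ◁ (∙ ⟵ ∙)) (◁-⟵-◁ α β γ)
  ; ◁-◁-◁ = λ α β γ → ≡-resp₂ ((∙ ◁ ∙) ◁ ((∙ ⟵ ∙) ◁ ∙)) (∙ ◁ ∙) (◁-◁-◁ α β γ)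
  ; ◁-⟶-◁ = λ α β γ → ≡-resp₂ ((∙ ◁ ∙) ⟶ ((∙ ⟵ ∙) ◁ ∙)) (∙ ◁ (∙ ⟶ ∙)) (◁-⟶-◁ α β γ)
  ; ◁-▷-◁ = λ α β γ → ≡-resp₂ ((∙ ◁ ∙) ▷ ((∙ ⟵ ∙) ◁ ∙)) (∙ ▷ ∙) (◁-▷-◁ α β γ)
  ; ▷-⟵-▷ = λ α β γ → ≡-resp₂ ((∙ ▷ (∙ ⟶ ∙)) ⟵ (∙ ▷ ∙)) ((∙ ⟵ ∙) ▷ ∙) (▷-⟵-▷ α β γ)
  ; ▷-◁-▷ = λ α β γ → ≡-resp₂ ((∙ ▷ (∙ ⟶ ∙)) ◁ (∙ ▷ ∙)) (∙ ◁ ∙) (▷-◁-▷ α β γ)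
  ; ▷-⟶-▷ = λ α β γ → ≡-resp₂ ((∙ ▷ (∙ ⟶ ∙)) ⟶ (∙ ▷ ∙)) ((∙ ⟶ ∙) ▷ ∙) (▷-⟶-▷ α β γ)
  ; ▷-▷-▷ = λ α β γ → ≡-resp₂ ((∙ ▷ (∙ ⟶ ∙)) ▷ (∙ ▷ ∙)) (∙ ▷ ∙) (▷-▷-▷ α β γ)
  }
  where
  open IsEDS eds

  ∙ : ∀ {α} → α ≡ α
  ∙ = refl
  open Congruence ⟵≈ renaming (_⟨∙⟩_ to _⟵_)
  open Congruence ⟶≈ renaming (_⟨∙⟩_ to _⟶_)
  open Congruence ◁≈ renaming (_⟨∙⟩_ to _◁_)
  open Congruence ▷≈ renaming (_⟨∙⟩_ to _▷_)

≈DS⇒≅DS : ∀ {Ω : Set} {R S : RawDS Ω} → R ≈DS S → R ≅DS S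
≈DS⇒≅DS R≈S = ↔-id _ , R≈S

≈EDS⇒≅EDS : ∀ {Ω : Set} {R S : RawEDS Ω} → R ≈EDS S → R ≅EDS S
≈EDS⇒≅EDS ((p , q) , r , s) = ↔-id _ , p , q , r , s

-- Tables of values

-- Nested pairs serve as codes because propositional equality of tables captures pointwise equality
-- of operations, and listings of them arise as products of `two`.
Table DSTable EDSTable : Set
Table    = (Two × Two) × (Two × Two)
DSTable  = Table × Table
EDSTable = DSTable × DSTable

tables : Listing {Table} U
tables = ×-listing-U (×-listing-U two two) (×-listing-U two two)

table : Op₂ Two → Table
table f = (f a a , f a b) , (f b a , f b b)

⟦_⟧ : Table → Op₂ Two
⟦ (p , q) , (r , s) ⟧ a a = p
⟦ (p , q) , (r , s) ⟧ a b = q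
⟦ (p , q) , (r , s) ⟧ b a = r
⟦ (p , q) , (r , s) ⟧ b b = s

≈-table : ∀ f → f ≈Op ⟦ table f ⟧
≈-table f a a = refl
≈-table f a b = refl
≈-table f b a = refl
≈-table f b b = refl

table-cong : ∀ {f g} → f ≈Op g → table f ≡ table g
table-cong f≈g = cong₂ _,_ (cong₂ _,_ (f≈g a a) (f≈g a b)) (cong₂ _,_ (f≈g b a) (f≈g b b))

dsTable : RawDS Two → DSTable
dsTable R = table R._⟵_ , table R._⟶_
  where module R = RawDS R

ds⟦_⟧ : DSTable → RawDS Two
ds⟦ t , u ⟧ = rawDS ⟦ t ⟧ ⟦ u ⟧

≈-dsTable : ∀ R → R ≈DS ds⟦ dsTable R ⟧
≈-dsTable R = ≈-table _ , ≈-table _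

dsTable-cong : ∀ {R S} → R ≈DS S → dsTable R ≡ dsTable S
dsTable-cong (p , q) = cong₂ _,_ (table-cong p) (table-cong q)

edsTable : RawEDS Two → EDSTable
edsTable R = dsTable R.rawDSPart , table R._◁_ , table R._▷_
  where module R = RawEDS R

eds⟦_⟧ : EDSTable → RawEDS Two
eds⟦ d , t , u ⟧ = rawEDS ds⟦ d ⟧ ⟦ t ⟧ ⟦ u ⟧

≈-edsTable : ∀ R → R ≈EDS eds⟦ edsTable R ⟧
≈-edsTable R = ≈-dsTable _ , ≈-table _ , ≈-table _

edsTable-cong : ∀ {R S} → R ≈EDS S → edsTable R ≡ edsTable S
edsTable-cong (d , p , q) = cong₂ _,_ (dsTable-cong d) (cong₂ _,_ (table-cong p) (table-cong q))

module ≈DS {Ω : Set} = IsEquivalence (≈DS-isEquivalence {Ω = Ω})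
module ≈EDS {Ω : Set} = IsEquivalence (≈EDS-isEquivalence {Ω = Ω})

IsDSTable : DSTable → Set
IsDSTable d = IsDiassociativeSemigroup ds⟦ d ⟧

IsEDSTable : EDSTable → Set
IsEDSTable e = IsEDS eds⟦ e ⟧

dsTables : Listing IsDSTable
dsTables = filter-listing _ (isDiassociativeSemigroup? ∘ ds⟦_⟧) (×-listing-U tables tables)

-- Extending only the 13 diassociative tables, instead of searching all 16⁴
-- quadruples, keeps the enumeration small.
edsTables : Listing IsEDSTable
edsTables = filter-listing (λ e → IsEDS.isDiassociativeSemigroup e , tt)
  (isEDS? ∘ eds⟦_⟧) (×-listing dsTables (×-listing-U tables tables))

isDSTable : (S : DiassociativeSemigroup Two) → IsDSTable (dsTable (DiassociativeSemigroup.raw S))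
isDSTable S = IsDiassociativeSemigroup-resp (≈-dsTable raw) isDiassociativeSemigroup
  where open DiassociativeSemigroup S

isEDSTable : (S : EDS Two) → IsEDSTable (edsTable (EDS.raw S))
isEDSTable S = IsEDS-resp (≈-edsTable raw) isEDS
  where open EDS S

-- Counting the structures

DS-cardinality : HasCardinality (DS-setoid Two) 13
DS-cardinality = coded-cardinality (DS-setoid Two) dsTables
  (dsTable ∘ DiassociativeSemigroup.raw)
  isDSTable
  dsTable-cong
  (λ {R} {S} eq → ≈DS.trans (≈-dsTable (DiassociativeSemigroup.raw R))
    (≈DS.trans (≈DS.reflexive (cong ds⟦_⟧ eq))
               (≈DS.sym (≈-dsTable (DiassociativeSemigroup.raw S)))))
  -- Tabulating a decoded table returns it definitionally, by eta for pairs.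
  (λ d ok → record { raw = ds⟦ d ⟧ ; isDiassociativeSemigroup = ok } , refl)
  -- The count is computed here: evaluation filters the 256 pairs of tables by the axioms and
  -- measures the resulting list.
  refl

EDS-cardinality : HasCardinality (EDS-setoid Two) 45
EDS-cardinality = coded-cardinality (EDS-setoid Two) edsTables
  (edsTable ∘ EDS.raw)
  isEDSTable
  edsTable-cong
  (λ {R} {S} eq → ≈EDS.trans (≈-edsTable (EDS.raw R))
    (≈EDS.trans (≈EDS.reflexive (cong eds⟦_⟧ eq))
                (≈EDS.sym (≈-edsTable (EDS.raw S)))))
  (λ e ok → record { raw = eds⟦ e ⟧ ; isEDS = ok } , refl)
  refl

-- Representatives

dsLabel∈ : ∀ X → X ∈ A ∷ B ∷ C ∷ D ∷ E ∷ F ∷ G ∷ H ∷ []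
dsLabel∈ A = here refl
dsLabel∈ B = there (here refl)
dsLabel∈ C = there (there (here refl))
dsLabel∈ D = there (there (there (here refl)))
dsLabel∈ E = there (there (there (there (here refl))))
dsLabel∈ F = there (there (there (there (there (here refl)))))
dsLabel∈ G = there (there (there (there (there (there (here refl))))))
dsLabel∈ H = there (there (there (there (there (there (there (here refl)))))))

dsLabels : Listing {DSLabel} U
dsLabels = enumeration dsLabel∈

-- The number of extensions varies with the label, so the list concatenates the fibres over
-- `DSLabel` instead of forming a product.
edsLabel∈ : ∀ i → i ∈ concatMap (λ X → map (X ,_) (allFin (length (extensions X))))
                                (Listing.elements dsLabels)
edsLabel∈ (X , i) = ∈-concatMap⁺
  (λ Y → map (Y ,_) (allFin (length (extensions Y))))
  (lose (dsLabel∈ X) (∈-map⁺ (X ,_) (∈-allFin i)))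

edsLabels : Listing {EDSLabel} U
edsLabels = enumeration edsLabel∈

dsRep-isDS : ∀ X → IsDiassociativeSemigroup (dsRep X)
dsRep-isDS X = check dsLabels (isDiassociativeSemigroup? ∘ dsRep) X tt

edsRep-isEDS : ∀ i → IsEDS (edsRep i)
edsRep-isEDS i = check edsLabels (isEDS? ∘ edsRep) i tt

dsRep-injective : ∀ X Y → dsRep X ≅DS dsRep Y → X ≡ Y
dsRep-injective X Y = check dsLabels
  (λ X → ∀? dsLabels λ Y → (dsRep X ≅DS? dsRep Y) →-dec enumerable-≟ dsLabel∈ X Y) X tt Y

-- For each of the 24² pairs of labels, evaluation tests the identity and the swap as isomorphisms;
-- one of them succeeds only on the diagonal.
edsRep-injective : ∀ i j → edsRep i ≅EDS edsRep j → i ≡ j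
edsRep-injective i j = check edsLabels
  (λ i → ∀? edsLabels λ j → (edsRep i ≅EDS? edsRep j) →-dec enumerable-≟ edsLabel∈ i j) i tt j

-- Classification up to isomorphism

DS-classification : ∀ (S : DiassociativeSemigroup Two) →
                    ∃! _≡_ λ X → DiassociativeSemigroup.raw S ≅DS dsRep X
DS-classification S = ∃!-representative ≅DS-isEquivalence dsRep dsRep-injective
  (≈DS⇒≅DS (≈-dsTable (DiassociativeSemigroup.raw S)))
  -- Existence is a search over finitely many cases: each of the 13 valid tables is matched against
  -- the eight representatives.
  (check dsTables (λ d → ∃? dsLabels λ X → ds⟦ d ⟧ ≅DS? dsRep X) _ (isDSTable S))

EDS-classification : ∀ (S : EDS Two) → ∃! _≡_ λ i → EDS.raw S ≅EDS edsRep i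
EDS-classification S = ∃!-representative ≅EDS-isEquivalence edsRep edsRep-injective
  (≈EDS⇒≅EDS (≈-edsTable (EDS.raw S)))
  (check edsTables (λ e → ∃? edsLabels λ i → eds⟦ e ⟧ ≅EDS? edsRep i) _ (isEDSTable S))

DS-classes-cardinality : HasCardinality (DS-classes Two) 8
DS-classes-cardinality = classes-cardinality (DS-classes Two) dsLabels
  (λ X → record { raw = dsRep X ; isDiassociativeSemigroup = dsRep-isDS X })
  DS-classification refl

EDS-classes-cardinality : HasCardinality (EDS-classes Two) 24
EDS-classes-cardinality = classes-cardinality (EDS-classes Two) edsLabels
  (λ i → record { raw = edsRep i ; isEDS = edsRep-isEDS i })
  EDS-classification refl

-- Nondegenerate representatives

nondegenerateLabels-cardinality : HasCardinality nondegenerateLabels 4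
nondegenerateLabels-cardinality = coded-cardinality nondegenerateLabels
  (filter-listing _ (nondegenerate? ∘ edsRep) edsLabels)
  -- A label is its own code, and equality in this setoid is by definition equality of labels, hence
  -- the two occurrences of `id`.
  proj₁ proj₂ id id (λ i nd → (i , nd) , refl) refl

-- Membership in the list is taken up to `_≈EDS_`, which is decidable on `Two`, so the equivalence
-- is evaluated at each of the 24 labels.
nondegenerate⇔∈reps :
  ∀ i → Nondegenerate (edsRep i) ⇔ Any (λ R → edsRep i ≈EDS R) nondegenerateReps
nondegenerate⇔∈reps i = check edsLabels
  (λ i → nondegenerate? (edsRep i) ⇔-dec any? (edsRep i ≈EDS?_) nondegenerateReps) i tt

mainTheorem11 : HasCardinality (DS-setoid Two) 13
    × HasCardinality (DS-classes Two) 8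
    × HasCardinality (EDS-setoid Two) 45
    × HasCardinality (EDS-classes Two) 24
    × (∀ X → IsDiassociativeSemigroup (dsRep X))
    × (∀ (S : DiassociativeSemigroup Two) → ∃! _≡_ λ X → DiassociativeSemigroup.raw S ≅DS dsRep X)
    × (∀ i → IsEDS (edsRep i))
    × (∀ (S : EDS Two) → ∃! _≡_ λ i → EDS.raw S ≅EDS edsRep i)
    × HasCardinality nondegenerateLabels 4
    × (∀ i → Nondegenerate (edsRep i) ⇔ Any (λ R → edsRep i ≈EDS R) nondegenerateReps)
mainTheorem11 =
  DS-cardinality , DS-classes-cardinality , EDS-cardinality , EDS-classes-cardinality ,
  dsRep-isDS , DS-classification , edsRep-isEDS , EDS-classification ,
  nondegenerateLabels-cardinality , nondegenerate⇔∈reps
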